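{- Let $s\ge 2$, let $G$ be a metric star consisting of $s$ spikes of length one, and let $G_w$ be any graph obtained by adding $s-2$ wormholes to $G$. Then $\mathrm{diam}(G_w)=\mathrm{diam}(G)=2$.
   Context: A metric graph is a finite edge-weighted graph regarded as a metric space in which all points in the interior of each edge are included and each edge is locally isometric to an interval whose length is the edge weight; $d_G(x,y)$ is the minimum length of a path from $x$ to $y$, and $\mathrm{diam}(G)=\max_{x,y\in G} d_G(x,y)$ over all points of $G$ (not only vertices). The metric star with $s$ spikes of length one consists of $s$ intervals of length $1$ glued at a common endpoint. A wormhole is a pair of points of $G$ (arbitrary points, not necessarily vertices); adding a wormhole means identifying its two points, equivalently adding an edge of length zero between them. $G_w$ is the metric graph obtained after all the identifications. Different wormholes may share points. -}

module Defs where

open import Data.Fin using (Fin; zero; suc)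
open import Data.List using (List; []; _++_)
open import Data.List.Membership.Propositional using (_∈_)
open import Data.Nat as ℕ using (ℕ)
import Data.Nat.Properties as ℕ
open import Data.Product using (∃-syntax; _×_; _,_)
open import Data.Rational as ℚ using (ℚ; 0ℚ; 1ℚ; ½)
import Data.Rational.Properties as ℚ
open import Data.Rational.Solver using (module +-*-Solver)
open import Data.Sum using (inj₁; inj₂)
open import Data.Vec using (Vec; toList)
open import Relation.Binary.Construct.Closure.ReflexiveTransitive using (Star; ε; _◅_)
open import Relation.Binary.PropositionalEquality
  using (_≡_; refl; sym; trans; cong; subst)

------------------------------------------------------------------------
-- Real numbers as Cauchy sequences of rationals, compared up to _≈_.
-- No modulus is prescribed and operations are termwise; assuming excluded
-- middle this is the classical field ℝ with its decidable total order.

Eventually : (ℕ → Set) → Set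
Eventually P = ∃[ N ] (∀ n → N ℕ.≤ n → P n)

IsCauchy : (ℕ → ℚ) → Set
IsCauchy x = ∀ η → 0ℚ ℚ.< η →
  ∃[ N ] (∀ m n → N ℕ.≤ m → N ℕ.≤ n → ℚ.∣ x m ℚ.- x n ∣ ℚ.< η)

record ℝ : Set where
  constructor mkℝ
  field
    seq    : ℕ → ℚ
    cauchy : IsCauchy seq

open ℝ public

infix  4 _≈_ _≤_ _<_
infixl 6 _+_ _-_
infix  8 -_

_≈_ : ℝ → ℝ → Set
x ≈ y = ∀ η → 0ℚ ℚ.< η → Eventually λ n → ℚ.∣ seq x n ℚ.- seq y n ∣ ℚ.< η

-- The slack η is needed: representatives of equal reals may stay strictly
-- apart at every index.
_≤_ : ℝ → ℝ → Set
x ≤ y = ∀ η → 0ℚ ℚ.< η → Eventually λ n → seq x n ℚ.≤ seq y n ℚ.+ η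

_<_ : ℝ → ℝ → Set
x < y = ∃[ δ ] (0ℚ ℚ.< δ × Eventually λ n → seq x n ℚ.+ δ ℚ.≤ seq y n)

private
  half-pos : ∀ {η} → 0ℚ ℚ.< η → 0ℚ ℚ.< ½ ℚ.* η
  half-pos {η} 0<η = subst (ℚ._< ½ ℚ.* η) (ℚ.*-zeroʳ ½) (ℚ.*-monoʳ-<-pos ½ 0<η)

  half+half : ∀ η → ½ ℚ.* η ℚ.+ ½ ℚ.* η ≡ η
  half+half η = trans (sym (ℚ.*-distribʳ-+ η ½ ½)) (ℚ.*-identityˡ η)

  interchange : ∀ a b c d → (a ℚ.+ b) ℚ.- (c ℚ.+ d) ≡ (a ℚ.- c) ℚ.+ (b ℚ.- d)
  interchange = solve 4 (λ a b c d → (a :+ b) :- (c :+ d) := (a :- c) :+ (b :- d)) refl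
    where open +-*-Solver

  p-q+q : ∀ p q → (p ℚ.- q) ℚ.+ q ≡ p
  p-q+q = solve 2 (λ p q → (p :- q) :+ q := p) refl
    where open +-*-Solver

  r+q-q : ∀ r q → (r ℚ.+ q) ℚ.- q ≡ r
  r+q-q = solve 2 (λ r q → (r :+ q) :- q := r) refl
    where open +-*-Solver

  -[p-q] : ∀ p q → ℚ.- (p ℚ.- q) ≡ q ℚ.- p
  -[p-q] = solve 2 (λ p q → :- (p :- q) := q :- p) refl
    where open +-*-Solver

  neg-diff : ∀ p q → (ℚ.- p) ℚ.- (ℚ.- q) ≡ ℚ.- (p ℚ.- q)
  neg-diff = solve 2 (λ p q → (:- p) :- (:- q) := :- (p :- q)) refl
    where open +-*-Solver

  ∣p∣-∣q∣≤∣p-q∣ : ∀ p q → ℚ.∣ p ∣ ℚ.- ℚ.∣ q ∣ ℚ.≤ ℚ.∣ p ℚ.- q ∣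
  ∣p∣-∣q∣≤∣p-q∣ p q = begin
    ℚ.∣ p ∣ ℚ.- ℚ.∣ q ∣
      ≡⟨ cong (λ r → ℚ.∣ r ∣ ℚ.- ℚ.∣ q ∣) (sym (p-q+q p q)) ⟩
    ℚ.∣ (p ℚ.- q) ℚ.+ q ∣ ℚ.- ℚ.∣ q ∣
      ≤⟨ ℚ.+-monoˡ-≤ (ℚ.- ℚ.∣ q ∣) (ℚ.∣p+q∣≤∣p∣+∣q∣ (p ℚ.- q) q) ⟩
    (ℚ.∣ p ℚ.- q ∣ ℚ.+ ℚ.∣ q ∣) ℚ.- ℚ.∣ q ∣
      ≡⟨ r+q-q ℚ.∣ p ℚ.- q ∣ ℚ.∣ q ∣ ⟩
    ℚ.∣ p ℚ.- q ∣ ∎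
    where open ℚ.≤-Reasoning

  ∣∣p∣-∣q∣∣≤∣p-q∣ : ∀ p q → ℚ.∣ ℚ.∣ p ∣ ℚ.- ℚ.∣ q ∣ ∣ ℚ.≤ ℚ.∣ p ℚ.- q ∣
  ∣∣p∣-∣q∣∣≤∣p-q∣ p q with ℚ.∣p∣≡p∨∣p∣≡-p (ℚ.∣ p ∣ ℚ.- ℚ.∣ q ∣)
  ... | inj₁ eq = subst (ℚ._≤ ℚ.∣ p ℚ.- q ∣) (sym eq) (∣p∣-∣q∣≤∣p-q∣ p q)
  ... | inj₂ eq = begin
    ℚ.∣ ℚ.∣ p ∣ ℚ.- ℚ.∣ q ∣ ∣  ≡⟨ eq ⟩
    ℚ.- (ℚ.∣ p ∣ ℚ.- ℚ.∣ q ∣)  ≡⟨ -[p-q] ℚ.∣ p ∣ ℚ.∣ q ∣ ⟩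
    ℚ.∣ q ∣ ℚ.- ℚ.∣ p ∣        ≤⟨ ∣p∣-∣q∣≤∣p-q∣ q p ⟩
    ℚ.∣ q ℚ.- p ∣              ≡⟨ cong ℚ.∣_∣ (sym (-[p-q] p q)) ⟩
    ℚ.∣ ℚ.- (p ℚ.- q) ∣        ≡⟨ ℚ.∣-p∣≡∣p∣ (p ℚ.- q) ⟩
    ℚ.∣ p ℚ.- q ∣              ∎
    where open ℚ.≤-Reasoning

_+_ : ℝ → ℝ → ℝ
seq    (x + y) n = seq x n ℚ.+ seq y n
cauchy (x + y) η 0<η with cauchy x (½ ℚ.* η) (half-pos 0<η) | cauchy y (½ ℚ.* η) (half-pos 0<η)
... | M , p | N , q = M ℕ.⊔ N , λ m n m≥ n≥ → begin-strict
    ℚ.∣ (seq x m ℚ.+ seq y m) ℚ.- (seq x n ℚ.+ seq y n) ∣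
      ≡⟨ cong ℚ.∣_∣ (interchange (seq x m) (seq y m) (seq x n) (seq y n)) ⟩
    ℚ.∣ (seq x m ℚ.- seq x n) ℚ.+ (seq y m ℚ.- seq y n) ∣
      ≤⟨ ℚ.∣p+q∣≤∣p∣+∣q∣ (seq x m ℚ.- seq x n) (seq y m ℚ.- seq y n) ⟩
    ℚ.∣ seq x m ℚ.- seq x n ∣ ℚ.+ ℚ.∣ seq y m ℚ.- seq y n ∣
      <⟨ ℚ.+-mono-< (p m n (ℕ.m⊔n≤o⇒m≤o M N m≥) (ℕ.m⊔n≤o⇒m≤o M N n≥))
                    (q m n (ℕ.m⊔n≤o⇒n≤o M N m≥) (ℕ.m⊔n≤o⇒n≤o M N n≥)) ⟩
    ½ ℚ.* η ℚ.+ ½ ℚ.* η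
      ≡⟨ half+half η ⟩
    η ∎
    where open ℚ.≤-Reasoning

-_ : ℝ → ℝ
seq    (- x) n = ℚ.- seq x n
cauchy (- x) η 0<η with cauchy x η 0<η
... | N , p = N , λ m n m≥ n≥ →
  subst (ℚ._< η)
    (sym (trans (cong ℚ.∣_∣ (neg-diff (seq x m) (seq x n))) (ℚ.∣-p∣≡∣p∣ (seq x m ℚ.- seq x n))))
    (p m n m≥ n≥)

_-_ : ℝ → ℝ → ℝ
x - y = x + (- y)

∣_∣ : ℝ → ℝ
seq    ∣ x ∣ n = ℚ.∣ seq x n ∣
cauchy ∣ x ∣ η 0<η with cauchy x η 0<η
... | N , p = N , λ m n m≥ n≥ →
  ℚ.≤-<-trans (∣∣p∣-∣q∣∣≤∣p-q∣ (seq x m) (seq x n)) (p m n m≥ n≥)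

fromℚ : ℚ → ℝ
seq    (fromℚ q) _ = q
cauchy (fromℚ q) η 0<η = 0 , λ _ _ _ _ →
  subst (ℚ._< η) (sym (cong ℚ.∣_∣ (ℚ.+-inverseʳ q))) 0<η

0ℝ 1ℝ 2ℝ : ℝ
0ℝ = fromℚ 0ℚ
1ℝ = fromℚ 1ℚ
2ℝ = 1ℝ + 1ℝ

0<1 : 0ℝ < 1ℝ
0<1 = 1ℚ , ℚ.positive⁻¹ 1ℚ , 0 , λ _ _ → ℚ.≤-reflexive (ℚ.+-identityˡ 1ℚ)

------------------------------------------------------------------------
-- Metric graphs

record WeightedGraph : Set where
  field
    #vertices : ℕ
    #edges    : ℕ
    source    : Fin #edges → Fin #vertices
    target    : Fin #edges → Fin #vertices
    weight    : Fin #edges → ℝ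
    weight>0  : ∀ e → 0ℝ < weight e

-- Representatives of the points: edge e contributes the closed interval
-- [0 , weight e], whose two ends represent the same points as source e and
-- target e.
data Point (G : WeightedGraph) : Set where
  vertex : Fin (WeightedGraph.#vertices G) → Point G
  onEdge : (e : Fin (WeightedGraph.#edges G)) (t : ℝ) →
           0ℝ ≤ t → t ≤ WeightedGraph.weight G e → Point G

-- The metric graph obtained from a weighted graph by identifying, in addition,
-- the two points of every listed pair.
record MetricGraph : Set where
  field
    graph      : WeightedGraph
    identified : List (Point graph × Point graph)

  open WeightedGraph graph public

PointOf : MetricGraph → Set
PointOf G = Point (MetricGraph.graph G)

Wormhole : MetricGraph → Set
Wormhole G = PointOf G × PointOf G

addWormholes : ∀ {k} (G : MetricGraph) → Vec (Wormhole G) k → MetricGraph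
addWormholes G ws = record
  { graph      = MetricGraph.graph G
  ; identified = toList ws ++ MetricGraph.identified G
  }

module _ (G : MetricGraph) where
  open MetricGraph G

  data Glued : PointOf G → PointOf G → Set where
    atSource   : ∀ {e t p q} → t ≈ 0ℝ → Glued (vertex (source e)) (onEdge e t p q)
    atTarget   : ∀ {e t p q} → t ≈ weight e → Glued (vertex (target e)) (onEdge e t p q)
    byWormhole : ∀ {x y} → (x , y) ∈ identified → Glued x y

  data Step : PointOf G → PointOf G → Set where
    along : ∀ e {t u p q p′ q′} → Step (onEdge e t p q) (onEdge e u p′ q′)
    glue  : ∀ {x y} → Glued x y → Step x y
    glue⁻ : ∀ {x y} → Glued y x → Step x y

  stepLength : ∀ {x y} → Step x y → ℝ
  stepLength (along e {t} {u}) = ∣ t - u ∣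
  stepLength (glue _)          = 0ℝ
  stepLength (glue⁻ _)         = 0ℝ

  Path : PointOf G → PointOf G → Set
  Path = Star Step

  length : ∀ {x y} → Path x y → ℝ
  length ε       = 0ℝ
  length (s ◅ π) = stepLength s + length π

  IsDistance : PointOf G → PointOf G → ℝ → Set
  IsDistance x y d = (∃[ π ] length {x} {y} π ≈ d) × (∀ (π : Path x y) → d ≤ length π)

  -- d_G(x , y) is a relation here, so the first conjunct also asserts that it
  -- is defined everywhere.
  IsDiameter : ℝ → Set
  IsDiameter D = (∀ x y → ∃[ d ] (IsDistance x y d × d ≤ D))
               × (∃[ x ] ∃[ y ] IsDistance x y D)

-- Vertex zero is the centre and suc i the tip of spike i.
metricStar : ℕ → MetricGraph
metricStar s = record
  { graph = record
    { #vertices = ℕ.suc s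
    ; #edges    = s
    ; source    = λ _ → zero
    ; target    = suc
    ; weight    = λ _ → 1ℝ
    ; weight>0  = λ _ → 0<1
    }
  ; identified = []
  }

module Submission where

{- Lower bound.  If a wormhole joins (i , a) to (j , b) with a ≤ b and i ≠ j,
the 1-Lipschitz map (j , t) ↦ (i , max (t - (b - a)) 0), the identity on all
other spikes, retracts the star onto the star without spike j and sends both
ends of the wormhole to the same point.  If i = j, collapse spike j to the
centre.  After s - 2 such retractions two spikes and no wormhole remain, so
there is a 1-Lipschitz function on G_w whose values at two tips are 1 and -1.

Shortest paths.  They exist in the star and persist when a wormhole (a , b) is
added, since the new distance from x to y is
min (d x y) (min (d x a + d b y) (d x b + d a y)). -}

open import Defs hiding (_<_; _+_; _-_; -_; ∣_∣; length)
import Defs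
open import Level using (0ℓ)
import Algebra.Construct.NaturalChoice.Max as Max
import Algebra.Construct.NaturalChoice.MaxOp as MaxOp
import Algebra.Construct.NaturalChoice.Min as Min
import Algebra.Construct.NaturalChoice.MinOp as MinOp
open import Axiom.ExcludedMiddle using (ExcludedMiddle)
open import Data.Fin using (Fin; zero; suc; punchIn; punchOut; _≟_)
import Data.Fin.Properties as Fin
open import Data.List as List using (List; []; _∷_)
import Data.List.Properties as List
open import Data.List.Relation.Unary.All as All using (All; []; _∷_)
import Data.List.Relation.Unary.All.Properties as All
open import Data.List.Relation.Unary.Any using (here; there)
open import Data.Nat as ℕ using (ℕ; zero; suc; _∸_)
import Data.Nat.Properties as ℕ
open import Data.Product as Product using (∃-syntax; _×_; _,_; proj₁; proj₂)
open import Data.Rational as ℚ using (ℚ; 0ℚ; 1ℚ; ½)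
import Data.Rational.Properties as ℚ
open import Data.Rational.Solver using (module +-*-Solver)
open import Data.Sum using (_⊎_; inj₁; inj₂)
open import Data.Vec as Vec using (Vec; []; _∷_)
open import Data.Vec.Functional using (insertAt)
open import Data.Vec.Functional.Properties using (insertAt-lookup; insertAt-punchIn)
import Data.Vec.Properties as Vec
open import Function using (_∘_)
open import Relation.Binary.Bundles using (Poset; TotalOrder)
open import Relation.Binary.Construct.Closure.ReflexiveTransitive using (ε; _◅_; _◅◅_)
open import Relation.Binary.Construct.Interior.Symmetric as Interior
  using (SymInterior; _,_; lhs≤rhs; rhs≤lhs)
open import Relation.Binary.PropositionalEquality
  using (_≡_; refl; sym; trans; cong; cong₂; subst)
open import Relation.Nullary using (yes; no; contradiction)

open +-*-Solver using (solve; _:=_; _:+_; _:-_; :-_)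

-- Inequalities between rationals

p≤∣p∣ : ∀ p → p ℚ.≤ ℚ.∣ p ∣
p≤∣p∣ p with ℚ.≤-total 0ℚ p
... | inj₁ 0≤p = ℚ.≤-reflexive (sym (ℚ.0≤p⇒∣p∣≡p 0≤p))
... | inj₂ p≤0 = ℚ.≤-trans p≤0 (ℚ.0≤∣p∣ p)

p≤∣p-q∣+q : ∀ p q → p ℚ.≤ ℚ.∣ p ℚ.- q ∣ ℚ.+ q
p≤∣p-q∣+q p q = begin
  p                       ≡⟨ solve 2 (λ p q → p := (p :- q) :+ q) refl p q ⟩
  (p ℚ.- q) ℚ.+ q         ≤⟨ ℚ.+-monoˡ-≤ q (p≤∣p∣ (p ℚ.- q)) ⟩
  ℚ.∣ p ℚ.- q ∣ ℚ.+ q     ∎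
  where open ℚ.≤-Reasoning

∣p-q∣≡∣q-p∣ : ∀ p q → ℚ.∣ p ℚ.- q ∣ ≡ ℚ.∣ q ℚ.- p ∣
∣p-q∣≡∣q-p∣ p q = trans (sym (ℚ.∣-p∣≡∣p∣ (p ℚ.- q)))
  (cong ℚ.∣_∣ (solve 2 (λ p q → :- (p :- q) := q :- p) refl p q))

∣p-r∣≤∣p-q∣+∣q-r∣ : ∀ p q r → ℚ.∣ p ℚ.- r ∣ ℚ.≤ ℚ.∣ p ℚ.- q ∣ ℚ.+ ℚ.∣ q ℚ.- r ∣
∣p-r∣≤∣p-q∣+∣q-r∣ p q r = subst (λ z → ℚ.∣ z ∣ ℚ.≤ ℚ.∣ p ℚ.- q ∣ ℚ.+ ℚ.∣ q ℚ.- r ∣)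
  (solve 3 (λ p q r → (p :- q) :+ (q :- r) := p :- r) refl p q r)
  (ℚ.∣p+q∣≤∣p∣+∣q∣ (p ℚ.- q) (q ℚ.- r))

∣p∣<q : ∀ {p q} → p ℚ.< q → ℚ.- p ℚ.< q → ℚ.∣ p ∣ ℚ.< q
∣p∣<q {p} {q} p<q -p<q with ℚ.∣p∣≡p∨∣p∣≡-p p
... | inj₁ eq = subst (ℚ._< q) (sym eq) p<q
... | inj₂ eq = subst (ℚ._< q) (sym eq) -p<q

∣p∣≤q : ∀ {p q} → p ℚ.≤ q → ℚ.- p ℚ.≤ q → ℚ.∣ p ∣ ℚ.≤ q
∣p∣≤q {p} {q} p≤q -p≤q with ℚ.∣p∣≡p∨∣p∣≡-p p
... | inj₁ eq = subst (ℚ._≤ q) (sym eq) p≤q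
... | inj₂ eq = subst (ℚ._≤ q) (sym eq) -p≤q

p≤q+r⇒p-q≤r : ∀ {p r} q → p ℚ.≤ q ℚ.+ r → p ℚ.- q ℚ.≤ r
p≤q+r⇒p-q≤r {p} {r} q p≤q+r = subst (p ℚ.- q ℚ.≤_)
  (solve 2 (λ q r → (q :+ r) :- q := r) refl q r) (ℚ.+-monoˡ-≤ (ℚ.- q) p≤q+r)

-- Carries a comparison made at one index of two Cauchy sequences to any other late index: each
-- sequence contributes an error of at most `r`.
perturb-≤ : ∀ p p′ q q′ {c r} →
  ℚ.∣ p ℚ.- p′ ∣ ℚ.< r → ℚ.∣ q′ ℚ.- q ∣ ℚ.< r → p′ ℚ.≤ q′ ℚ.+ c → p ℚ.≤ q ℚ.+ (c ℚ.+ (r ℚ.+ r))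
perturb-≤ p p′ q q′ {c} {r} ∣p-p′∣<r ∣q′-q∣<r p′≤q′+c = begin
  p                                      ≤⟨ p≤∣p-q∣+q p p′ ⟩
  ℚ.∣ p ℚ.- p′ ∣ ℚ.+ p′                  ≤⟨ ℚ.+-mono-≤ (ℚ.<⇒≤ ∣p-p′∣<r) p′≤q′+c ⟩
  r ℚ.+ (q′ ℚ.+ c)                       ≤⟨ ℚ.+-monoʳ-≤ r (ℚ.+-monoˡ-≤ c (p≤∣p-q∣+q q′ q)) ⟩
  r ℚ.+ ((ℚ.∣ q′ ℚ.- q ∣ ℚ.+ q) ℚ.+ c)
    ≤⟨ ℚ.+-monoʳ-≤ r (ℚ.+-monoˡ-≤ c (ℚ.+-monoˡ-≤ q (ℚ.<⇒≤ ∣q′-q∣<r))) ⟩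
  r ℚ.+ ((r ℚ.+ q) ℚ.+ c)
    ≡⟨ solve 3 (λ q c r → r :+ ((r :+ q) :+ c) := q :+ (c :+ (r :+ r))) refl q c r ⟩
  q ℚ.+ (c ℚ.+ (r ℚ.+ r))                ∎
  where open ℚ.≤-Reasoning

0<½*η : ∀ {η} → 0ℚ ℚ.< η → 0ℚ ℚ.< ½ ℚ.* η
0<½*η {η} 0<η = subst (ℚ._< ½ ℚ.* η) (ℚ.*-zeroʳ ½) (ℚ.*-monoʳ-<-pos ½ 0<η)

½*η+½*η≡η : ∀ η → ½ ℚ.* η ℚ.+ ½ ℚ.* η ≡ η
½*η+½*η≡η η = trans (sym (ℚ.*-distribʳ-+ η ½ ½)) (ℚ.*-identityˡ η)

½*η<η : ∀ {η} → 0ℚ ℚ.< η → ½ ℚ.* η ℚ.< η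
½*η<η {η} 0<η = begin-strict
  ½ ℚ.* η              ≡⟨ ℚ.+-identityʳ _ ⟨
  ½ ℚ.* η ℚ.+ 0ℚ       <⟨ ℚ.+-monoʳ-< (½ ℚ.* η) (0<½*η 0<η) ⟩
  ½ ℚ.* η ℚ.+ ½ ℚ.* η  ≡⟨ ½*η+½*η≡η η ⟩
  η                    ∎
  where open ℚ.≤-Reasoning

p≤p+η : ∀ {η} p → 0ℚ ℚ.< η → p ℚ.≤ p ℚ.+ η
p≤p+η {η} p 0<η = subst (ℚ._≤ p ℚ.+ η) (ℚ.+-identityʳ p) (ℚ.+-monoʳ-≤ p (ℚ.<⇒≤ 0<η))

-- Order and addition on the Cauchy reals

eventually₂ : ∀ {P Q R : ℕ → Set} → (∀ n → P n → Q n → R n) →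
              Eventually P → Eventually Q → Eventually R
eventually₂ f (M , p) (N , q) = M ℕ.⊔ N , λ n n≥ →
  f n (p n (ℕ.m⊔n≤o⇒m≤o M N n≥)) (q n (ℕ.m⊔n≤o⇒n≤o M N n≥))

pointwise-≤ : ∀ {x y} → (∀ n → seq x n ℚ.≤ seq y n) → x ≤ y
pointwise-≤ {x} {y} p η 0<η = 0 , λ n _ → ℚ.≤-trans (p n) (p≤p+η (seq y n) 0<η)

≤-trans : ∀ x y z → x ≤ y → y ≤ z → x ≤ z
≤-trans x y z p q η 0<η = eventually₂
  (λ n xy yz → begin
    seq x n                                ≤⟨ xy ⟩
    seq y n ℚ.+ ½ ℚ.* η                    ≤⟨ ℚ.+-monoˡ-≤ (½ ℚ.* η) yz ⟩
    (seq z n ℚ.+ ½ ℚ.* η) ℚ.+ ½ ℚ.* η      ≡⟨ ℚ.+-assoc (seq z n) _ _ ⟩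
    seq z n ℚ.+ (½ ℚ.* η ℚ.+ ½ ℚ.* η)      ≡⟨ cong (seq z n ℚ.+_) (½*η+½*η≡η η) ⟩
    seq z n ℚ.+ η                          ∎)
  (p _ (0<½*η 0<η)) (q _ (0<½*η 0<η))
  where open ℚ.≤-Reasoning

≤-antisym : ∀ x y → x ≤ y → y ≤ x → x ≈ y
≤-antisym x y p q η 0<η = eventually₂
  (λ n xy yx → ∣p∣<q
    (ℚ.≤-<-trans (p≤q+r⇒p-q≤r (seq y n) xy) (½*η<η 0<η))
    (subst (ℚ._< η) (solve 2 (λ p q → q :- p := :- (p :- q)) refl (seq x n) (seq y n))
      (ℚ.≤-<-trans (p≤q+r⇒p-q≤r (seq x n) yx) (½*η<η 0<η))))
  (p _ (0<½*η 0<η)) (q _ (0<½*η 0<η))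

+-mono-≤ : ∀ x y z w → x ≤ y → z ≤ w → x Defs.+ z ≤ y Defs.+ w
+-mono-≤ x y z w p q η 0<η = eventually₂
  (λ n xy zw → ℚ.≤-trans (ℚ.+-mono-≤ xy zw) (ℚ.≤-reflexive (trans
    (solve 3 (λ y w h → (y :+ h) :+ (w :+ h) := (y :+ w) :+ (h :+ h)) refl
      (seq y n) (seq w n) (½ ℚ.* η))
    (cong (seq y n ℚ.+ seq w n ℚ.+_) (½*η+½*η≡η η)))))
  (p _ (0<½*η 0<η)) (q _ (0<½*η 0<η))

-- Suppose `y ≤ x` fails. For each slack η one comparison of rationals, at an index past which both
-- sequences vary little, settles the matter: either the wanted bound holds from there on, or `y`
-- lies termwise below `x` from there on, which was excluded.
≤-total : ExcludedMiddle 0ℓ → ∀ x y → x ≤ y ⊎ y ≤ x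
≤-total em x y with em {P = y ≤ x}
... | yes y≤x = inj₂ y≤x
... | no  y≰x = inj₁ x≤y
  where
  x≤y : x ≤ y
  x≤y η 0<η = compare (ℚ.≤-total (seq x K) (seq y K ℚ.+ h))
    where
    -- Passing from `K` to another index costs two errors of `q`, together `h`. In the first case
    -- below the slack becomes `h + h`, which is η; in the second the margin `h` is used up exactly.
    h q : ℚ
    h = ½ ℚ.* η
    q = ½ ℚ.* h

    x-tail = cauchy x q (0<½*η (0<½*η 0<η))
    y-tail = cauchy y q (0<½*η (0<½*η 0<η))

    M N K : ℕ
    M = proj₁ x-tail
    N = proj₁ y-tail
    K = M ℕ.⊔ N

    x-close : ∀ m n → K ℕ.≤ m → K ℕ.≤ n → ℚ.∣ seq x m ℚ.- seq x n ∣ ℚ.< q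
    x-close m n m≥ n≥ = proj₂ x-tail m n (ℕ.m⊔n≤o⇒m≤o M N m≥) (ℕ.m⊔n≤o⇒m≤o M N n≥)

    y-close : ∀ m n → K ℕ.≤ m → K ℕ.≤ n → ℚ.∣ seq y m ℚ.- seq y n ∣ ℚ.< q
    y-close m n m≥ n≥ = proj₂ y-tail m n (ℕ.m⊔n≤o⇒n≤o M N m≥) (ℕ.m⊔n≤o⇒n≤o M N n≥)

    compare : seq x K ℚ.≤ seq y K ℚ.+ h ⊎ seq y K ℚ.+ h ℚ.≤ seq x K →
              Eventually λ n → seq x n ℚ.≤ seq y n ℚ.+ η
    compare (inj₁ x≤y+h) = K , λ n n≥ → subst (λ z → seq x n ℚ.≤ seq y n ℚ.+ z)
      (trans (cong (h ℚ.+_) (½*η+½*η≡η h)) (½*η+½*η≡η η))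
      (perturb-≤ (seq x n) (seq x K) (seq y n) (seq y K)
        (x-close n K n≥ ℕ.≤-refl) (y-close K n ℕ.≤-refl n≥) x≤y+h)
    compare (inj₂ y+h≤x) = contradiction (λ ε 0<ε → K , λ n n≥ →
      ℚ.≤-trans (subst (seq y n ℚ.≤_)
        (trans (cong (λ z → seq x n ℚ.+ (ℚ.- h ℚ.+ z)) (½*η+½*η≡η h))
          (solve 2 (λ p r → p :+ (:- r :+ r) := p) refl (seq x n) h))
        (perturb-≤ (seq y n) (seq y K) (seq x n) (seq x K)
          (y-close n K n≥ ℕ.≤-refl) (x-close K n ℕ.≤-refl n≥)
          (subst (ℚ._≤ seq x K ℚ.- h)
            (solve 2 (λ p r → (p :+ r) :- r := p) refl (seq y K) h)
            (ℚ.+-monoˡ-≤ (ℚ.- h) y+h≤x))))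
        (p≤p+η (seq x n) 0<ε)) y≰x

-- Unfolded, sums and inequalities of reals expose Cauchy proofs and quantified
-- statements about sequences, which defeat unification; hence opaque copies.
infix  4 _≼_ _≋_
infixl 6 _⊕_ _⊖_

opaque
  𝟘 𝟙 : ℝ
  𝟘 = 0ℝ
  𝟙 = 1ℝ

  _⊕_ _⊖_ gap : ℝ → ℝ → ℝ
  x ⊕ y   = x Defs.+ y
  x ⊖ y   = x Defs.- y
  gap x y = Defs.∣ x Defs.- y ∣

  _≼_ : ℝ → ℝ → Set
  x ≼ y = x ≤ y

-- Equality as a pair of opposite inequalities makes `≼` antisymmetric by construction; `≋⇒≈`
-- returns to the equality of Cauchy sequences.
_≋_ : ℝ → ℝ → Set
_≋_ = SymInterior _≼_

opaque
  unfolding _≼_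

  ≼⇒≤ : ∀ {x y} → x ≼ y → x ≤ y
  ≼⇒≤ p = p

  ≤⇒≼ : ∀ {x y} → x ≤ y → x ≼ y
  ≤⇒≼ p = p

  pointwise : ∀ {x y} → (∀ n → seq x n ≡ seq y n) → x ≋ y
  pointwise {x} {y} p = pointwise-≤ {x} {y} (λ n → ℚ.≤-reflexive (p n))
                      , pointwise-≤ {y} {x} (λ n → ℚ.≤-reflexive (sym (p n)))

  ≼-refl : ∀ {x} → x ≼ x
  ≼-refl {x} = pointwise-≤ {x} {x} λ _ → ℚ.≤-refl

  ≼-trans : ∀ {x y z} → x ≼ y → y ≼ z → x ≼ z
  ≼-trans {x} {y} {z} = ≤-trans x y z

  ≋⇒≈ : ∀ {x y} → x ≋ y → x ≈ y
  ≋⇒≈ {x} {y} (p , q) = ≤-antisym x y p q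

  ≼-total : ExcludedMiddle 0ℓ → ∀ x y → x ≼ y ⊎ y ≼ x
  ≼-total = ≤-total

  0≼1 : 𝟘 ≼ 𝟙
  0≼1 = pointwise-≤ {0ℝ} {1ℝ} λ _ → ℚ.<⇒≤ (ℚ.positive⁻¹ 1ℚ)

  gap≼0 : ∀ {x y} → x ≈ y → gap x y ≼ 𝟘
  gap≼0 p η 0<η = let N , h = p η 0<η in
    N , λ n n≥ → ℚ.≤-trans (ℚ.<⇒≤ (h n n≥)) (ℚ.≤-reflexive (sym (ℚ.+-identityˡ η)))

  gap≼ : ∀ {x y z} → x ≼ z ⊕ y → y ≼ z ⊕ x → gap x y ≼ z
  gap≼ {x} {y} {z} p q η 0<η = eventually₂
    (λ n xy yx → ∣p∣≤q
      (p≤q+r⇒p-q≤r (seq y n) (subst (seq x n ℚ.≤_) (rearrange (seq z n) (seq y n) η) xy))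
      (subst (ℚ._≤ seq z n ℚ.+ η)
        (solve 2 (λ p q → q :- p := :- (p :- q)) refl (seq x n) (seq y n))
        (p≤q+r⇒p-q≤r (seq x n) (subst (seq y n ℚ.≤_) (rearrange (seq z n) (seq x n) η) yx))))
    (p η 0<η) (q η 0<η)
    where
    rearrange : ∀ p q r → (p ℚ.+ q) ℚ.+ r ≡ q ℚ.+ (p ℚ.+ r)
    rearrange = solve 3 (λ p q r → (p :+ q) :+ r := q :+ (p :+ r)) refl

  0≼gap : ∀ x y → 𝟘 ≼ gap x y
  0≼gap x y = pointwise-≤ {0ℝ} {Defs.∣ x Defs.- y ∣} λ n → ℚ.0≤∣p∣ (seq x n ℚ.- seq y n)

  x≼gap⊕y : ∀ x y → x ≼ gap x y ⊕ y
  x≼gap⊕y x y = pointwise-≤ {x} {Defs.∣ x Defs.- y ∣ Defs.+ y} λ n → p≤∣p-q∣+q (seq x n) (seq y n)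

  gap-sym : ∀ x y → gap x y ≋ gap y x
  gap-sym x y = pointwise λ n → ∣p-q∣≡∣q-p∣ (seq x n) (seq y n)

  gap-triangle : ∀ x y z → gap x z ≼ gap x y ⊕ gap y z
  gap-triangle x y z = pointwise-≤
    {Defs.∣ x Defs.- z ∣} {Defs.∣ x Defs.- y ∣ Defs.+ Defs.∣ y Defs.- z ∣}
    λ n → ∣p-r∣≤∣p-q∣+∣q-r∣ (seq x n) (seq y n) (seq z n)

  ⊕-mono : ∀ {x y z w} → x ≼ y → z ≼ w → x ⊕ z ≼ y ⊕ w
  ⊕-mono {x} {y} {z} {w} = +-mono-≤ x y z w

  ⊕-assoc : ∀ x y z → (x ⊕ y) ⊕ z ≋ x ⊕ (y ⊕ z)
  ⊕-assoc x y z = pointwise λ n → ℚ.+-assoc (seq x n) (seq y n) (seq z n)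

  ⊕-comm : ∀ x y → x ⊕ y ≋ y ⊕ x
  ⊕-comm x y = pointwise λ n → ℚ.+-comm (seq x n) (seq y n)

  ⊕-identityˡ : ∀ x → 𝟘 ⊕ x ≋ x
  ⊕-identityˡ x = pointwise λ n → ℚ.+-identityˡ (seq x n)

  x⊕y⊖y : ∀ x y → (x ⊕ y) ⊖ y ≋ x
  x⊕y⊖y x y = pointwise λ n →
    solve 2 (λ x y → (x :+ y) :- y := x) refl (seq x n) (seq y n)

  [x⊕y]⊖z : ∀ x y z → (x ⊕ y) ⊖ z ≋ x ⊕ (y ⊖ z)
  [x⊕y]⊖z x y z = pointwise λ n → ℚ.+-assoc (seq x n) (seq y n) (ℚ.- seq z n)

  ⊖-monoˡ : ∀ {x y} z → x ≼ y → x ⊖ z ≼ y ⊖ z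
  ⊖-monoˡ {x} {y} z p = +-mono-≤ x y (Defs.- z) (Defs.- z) p (≼-refl {Defs.- z})

  ⊖-antitone : ∀ x y → 𝟘 ⊖ x ≼ gap x y ⊕ (𝟘 ⊖ y)
  ⊖-antitone x y = pointwise-≤ {0ℝ Defs.- x} {Defs.∣ x Defs.- y ∣ Defs.+ (0ℝ Defs.- y)} λ n →
    subst (ℚ._≤ ℚ.∣ seq x n ℚ.- seq y n ∣ ℚ.+ (0ℚ ℚ.- seq y n))
      (solve 3 (λ p q r → (q :- p) :+ (r :- q) := r :- p) refl (seq x n) (seq y n) 0ℚ)
      (ℚ.+-monoˡ-≤ (0ℚ ℚ.- seq y n)
        (subst (seq y n ℚ.- seq x n ℚ.≤_) (∣p-q∣≡∣q-p∣ (seq y n) (seq x n))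
          (p≤∣p∣ (seq y n ℚ.- seq x n))))

  y⊖[y⊖x] : ∀ x y → y ⊖ (y ⊖ x) ≋ x
  y⊖[y⊖x] x y = pointwise λ n →
    solve 2 (λ x y → y :- (y :- x) := x) refl (seq x n) (seq y n)

  0⊖0 : 𝟘 ⊖ 𝟘 ≋ 𝟘
  0⊖0 = pointwise λ _ → refl

  2⊖1 : (𝟙 ⊕ 𝟙) ⊕ (𝟘 ⊖ 𝟙) ≋ 𝟙
  2⊖1 = pointwise λ _ → refl

  𝟘≡0ℝ : 𝟘 ≡ 0ℝ
  𝟘≡0ℝ = refl

  𝟙≡1ℝ : 𝟙 ≡ 1ℝ
  𝟙≡1ℝ = refl

  𝟙⊕𝟙≋2ℝ : 𝟙 ⊕ 𝟙 ≋ 2ℝ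
  𝟙⊕𝟙≋2ℝ = pointwise {𝟙 ⊕ 𝟙} {2ℝ} λ _ → refl

≼-poset : Poset 0ℓ 0ℓ 0ℓ
≼-poset = Interior.poset {R = _≼_} ≼-refl ≼-trans

open Poset ≼-poset using (module Eq)
open import Relation.Binary.Reasoning.PartialOrder ≼-poset

⊕-monoˡ : ∀ {x y} z → x ≼ y → x ⊕ z ≼ y ⊕ z
⊕-monoˡ z p = ⊕-mono p ≼-refl

⊕-monoʳ : ∀ {x y} z → x ≼ y → z ⊕ x ≼ z ⊕ y
⊕-monoʳ z p = ⊕-mono ≼-refl p

⊕-identityʳ : ∀ x → x ⊕ 𝟘 ≋ x
⊕-identityʳ x = Eq.trans (⊕-comm x 𝟘) (⊕-identityˡ x)

⊕-cancelʳ : ∀ {x y} z → x ⊕ z ≼ y ⊕ z → x ≼ y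
⊕-cancelʳ {x} {y} z p = begin
  x            ≈⟨ x⊕y⊖y x z ⟨
  (x ⊕ z) ⊖ z  ≤⟨ ⊖-monoˡ z p ⟩
  (y ⊕ z) ⊖ z  ≈⟨ x⊕y⊖y y z ⟩
  y            ∎

x≼y⊕x : ∀ {x y} → 𝟘 ≼ y → x ≼ y ⊕ x
x≼y⊕x {x} {y} 0≼y = begin
  x      ≈⟨ ⊕-identityˡ x ⟨
  𝟘 ⊕ x  ≤⟨ ⊕-monoˡ x 0≼y ⟩
  y ⊕ x  ∎

module Order (em : ExcludedMiddle 0ℓ) where

  ≼-totalOrder : TotalOrder 0ℓ 0ℓ 0ℓ
  ≼-totalOrder = record
    { isTotalOrder = record { isPartialOrder = Poset.isPartialOrder ≼-poset ; total = ≼-total em } }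

  open Min ≼-totalOrder public using (_⊓_)
  open MinOp (Min.minOperator ≼-totalOrder) public
    using (⊓-sel) renaming (x⊓y≤x to x⊓y≼x; x⊓y≤y to x⊓y≼y)
  open Max ≼-totalOrder public using (_⊔_)
  open MaxOp (Max.maxOperator ≼-totalOrder) public
    using (⊔-lub) renaming (x≤x⊔y to x≼x⊔y; x≤y⊔x to x≼y⊔x)

-- Paths and potentials

module _ {G : MetricGraph} where

  -- Lengths rebuilt from the opaque operations; `len≡length` translates back to those in the
  -- definition of distance.
  stepLen : ∀ {x y} → Step G x y → ℝ
  stepLen (along _ {t} {u}) = gap t u
  stepLen (glue _)          = 𝟘
  stepLen (glue⁻ _)         = 𝟘

  len : ∀ {x y} → Path G x y → ℝ
  len ε       = 𝟘
  len (s ◅ π) = stepLen s ⊕ len π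

  opaque
    unfolding _≼_

    stepLen≡stepLength : ∀ {x y} (s : Step G x y) → stepLen s ≡ stepLength G s
    stepLen≡stepLength (along _) = refl
    stepLen≡stepLength (glue _)  = refl
    stepLen≡stepLength (glue⁻ _) = refl

    len≡length : ∀ {x y} (π : Path G x y) → len π ≡ Defs.length G π
    len≡length ε       = refl
    len≡length (s ◅ π) = cong₂ Defs._+_ (stepLen≡stepLength s) (len≡length π)

module _ (G : MetricGraph) where

  -- An upper bound on distance that carries its path. An inequality suffices, so concatenations
  -- need only be estimated.
  Reach : PointOf G → PointOf G → ℝ → Set
  Reach x y d = ∃[ π ] len {G} {x} {y} π ≼ d

  -- The local form of being 1-Lipschitz, checked on single steps. Potentials are the source of all
  -- lower bounds on path lengths.
  Potential : (PointOf G → ℝ) → Set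
  Potential Φ = ∀ {x y} (s : Step G x y) → Φ x ≼ stepLen s ⊕ Φ y

  -- Existence of shortest paths: by `lower`, the path given by `reach` has length exactly `dist`.
  record Metric : Set where
    field
      dist  : PointOf G → PointOf G → ℝ
      reach : ∀ x y → Reach x y (dist x y)
      lower : ∀ {x y} (π : Path G x y) → dist x y ≼ len π

module _ {G : MetricGraph} where

  0≼stepLen : ∀ {x y} (s : Step G x y) → 𝟘 ≼ stepLen s
  0≼stepLen (along e {t} {u}) = 0≼gap t u
  0≼stepLen (glue _)          = ≼-refl
  0≼stepLen (glue⁻ _)         = ≼-refl

  0≼len : ∀ {x y} (π : Path G x y) → 𝟘 ≼ len π
  0≼len ε       = ≼-refl
  0≼len (s ◅ π) = ≼-trans (0≼len π) (x≼y⊕x (0≼stepLen s))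

  len-◅◅ : ∀ {x y z} (π : Path G x y) (ρ : Path G y z) →
           len (π ◅◅ ρ) ≼ len π ⊕ len ρ
  len-◅◅ ε       ρ = x≼y⊕x ≼-refl
  len-◅◅ (s ◅ π) ρ = begin
    stepLen s ⊕ len (π ◅◅ ρ)     ≤⟨ ⊕-monoʳ (stepLen s) (len-◅◅ π ρ) ⟩
    stepLen s ⊕ (len π ⊕ len ρ)  ≈⟨ ⊕-assoc (stepLen s) (len π) (len ρ) ⟨
    (stepLen s ⊕ len π) ⊕ len ρ  ∎

  reach-weaken : ∀ {x y c d} → c ≼ d → Reach G x y c → Reach G x y d
  reach-weaken c≼d (π , p) = π , ≼-trans p c≼d

  reach-trans : ∀ {x y z} c d → Reach G x y c → Reach G y z d → Reach G x z (c ⊕ d)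
  reach-trans c d (π , p) (ρ , q) = π ◅◅ ρ , ≼-trans (len-◅◅ π ρ) (⊕-mono p q)

  reach-step : ∀ {x y} (s : Step G x y) → Reach G x y (stepLen s)
  reach-step s = s ◅ ε , lhs≤rhs (⊕-identityʳ (stepLen s))

  -- The one-step inequalities telescope along the path.
  potential⇒≼len : ∀ {Φ} → Potential G Φ → ∀ {x y} (π : Path G x y) → Φ x ≼ len π ⊕ Φ y
  potential⇒≼len pot ε = x≼y⊕x ≼-refl
  potential⇒≼len {Φ} pot {x} {y} (_◅_ {j = z} s π) = begin
    Φ x                         ≤⟨ pot s ⟩
    stepLen s ⊕ Φ z             ≤⟨ ⊕-monoʳ (stepLen s) (potential⇒≼len pot π) ⟩
    stepLen s ⊕ (len π ⊕ Φ y)   ≈⟨ ⊕-assoc (stepLen s) (len π) (Φ y) ⟨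
    (stepLen s ⊕ len π) ⊕ Φ y   ∎

  module _ (M : Metric G) where
    open Metric M

    0≼dist : ∀ x y → 𝟘 ≼ dist x y
    0≼dist x y = ≼-trans (0≼len (proj₁ (reach x y))) (proj₂ (reach x y))

    -- Prepending the step to a shortest path from its end gives a competitor for the distance from
    -- its start.
    dist-potential : ∀ y → Potential G (λ x → dist x y)
    dist-potential y {x} {z} s = ≼-trans (lower (s ◅ proj₁ (reach z y)))
      (⊕-monoʳ (stepLen s) (proj₂ (reach z y)))

    isDistance : ∀ x y → IsDistance G x y (dist x y)
    isDistance x y =
      (π , subst (_≈ dist x y) (len≡length π) (≋⇒≈ (π≼d , lower π))) ,
      λ ρ → subst (dist x y ≤_) (len≡length ρ) (≼⇒≤ (lower ρ))
      where
      π   = proj₁ (reach x y)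
      π≼d = proj₂ (reach x y)

-- Shortest paths after adding one wormhole

module AddWormhole (em : ExcludedMiddle 0ℓ) {G : MetricGraph} (M : Metric G) (a b : PointOf G) where
  open Order em
  open Metric M

  G′ : MetricGraph
  G′ = addWormholes G ((a , b) ∷ [])

  lift-glued : ∀ {x y} → Glued G x y → Glued G′ x y
  lift-glued (atSource p)   = atSource p
  lift-glued (atTarget p)   = atTarget p
  lift-glued (byWormhole m) = byWormhole (there m)

  lift-step : ∀ {x y} → Step G x y → Step G′ x y
  lift-step (along e) = along e
  lift-step (glue g)  = glue (lift-glued g)
  lift-step (glue⁻ g) = glue⁻ (lift-glued g)

  lift : ∀ {x y} → Path G x y → Path G′ x y
  lift ε       = ε
  lift (s ◅ π) = lift-step s ◅ lift π

  len-lift : ∀ {x y} (π : Path G x y) → len (lift π) ≡ len π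
  len-lift ε                     = refl
  len-lift (along e {t} {u} ◅ π) = cong (gap t u ⊕_) (len-lift π)
  len-lift (glue _ ◅ π)          = cong (𝟘 ⊕_) (len-lift π)
  len-lift (glue⁻ _ ◅ π)         = cong (𝟘 ⊕_) (len-lift π)

  lift-reach : ∀ {x y d} → Reach G x y d → Reach G′ x y d
  lift-reach {d = d} (π , p) = lift π , subst (_≼ d) (sym (len-lift π)) p

  -- By totality the minimum is one of its two arguments, so a path that attains it can be picked.
  reach-⊓ : ∀ {x y} c d → Reach G′ x y c → Reach G′ x y d → Reach G′ x y (c ⊓ d)
  reach-⊓ c d r r′ with ⊓-sel c d
  ... | inj₁ eq = reach-weaken (rhs≤lhs eq) r
  ... | inj₂ eq = reach-weaken (rhs≤lhs eq) r′

  ⊕-⊓-glb : ∀ {c} δ p q → c ≼ δ ⊕ p → c ≼ δ ⊕ q → c ≼ δ ⊕ (p ⊓ q)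
  ⊕-⊓-glb δ p q c≼δ+p c≼δ+q with ⊓-sel p q
  ... | inj₁ eq = ≼-trans c≼δ+p (⊕-monoʳ δ (rhs≤lhs eq))
  ... | inj₂ eq = ≼-trans c≼δ+q (⊕-monoʳ δ (rhs≤lhs eq))

  -- The two detours cross the wormhole once, in either direction. That repeated crossings gain
  -- nothing is not shown by shortening paths: it follows once `dist′` is a potential on the new
  -- graph.
  via via⁻ dist′ : PointOf G → PointOf G → ℝ
  via   x y = dist x a ⊕ dist b y
  via⁻  x y = dist x b ⊕ dist a y
  dist′ x y = dist x y ⊓ (via x y ⊓ via⁻ x y)

  dist′≼dist : ∀ x y → dist′ x y ≼ dist x y
  dist′≼dist x y = x⊓y≼x (dist x y) (via x y ⊓ via⁻ x y)

  dist′≼via : ∀ x y → dist′ x y ≼ via x y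
  dist′≼via x y = ≼-trans (x⊓y≼y (dist x y) (via x y ⊓ via⁻ x y)) (x⊓y≼x (via x y) (via⁻ x y))

  dist′≼via⁻ : ∀ x y → dist′ x y ≼ via⁻ x y
  dist′≼via⁻ x y = ≼-trans (x⊓y≼y (dist x y) (via x y ⊓ via⁻ x y)) (x⊓y≼y (via x y) (via⁻ x y))

  reach-across : ∀ x y {u v} (s : Step G′ u v) → stepLen s ≡ 𝟘 →
                 Reach G′ x y (dist x u ⊕ dist v y)
  reach-across x y {u} {v} s eq = reach-trans (dist x u) (dist v y) (lift-reach (reach x u))
    (reach-weaken (lhs≤rhs (⊕-identityˡ (dist v y)))
      (reach-trans 𝟘 (dist v y)
        (subst (Reach G′ u v) eq (reach-step s))
        (lift-reach (reach v y))))

  reach′ : ∀ x y → Reach G′ x y (dist′ x y)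
  reach′ x y = reach-⊓ (dist x y) (via x y ⊓ via⁻ x y) (lift-reach (reach x y))
    (reach-⊓ (via x y) (via⁻ x y)
      (reach-across x y (glue (byWormhole (here refl))) refl)
      (reach-across x y (glue⁻ (byWormhole (here refl))) refl))

  module _ (y : PointOf G) where

    -- An old step changes each of the three competing terms by at most its length, hence also their
    -- minimum.
    along-G : ∀ {x z} (s : Step G x z) → dist′ x y ≼ stepLen s ⊕ dist′ z y
    along-G {x} {z} s = ⊕-⊓-glb δ (dist z y) (via z y ⊓ via⁻ z y)
      (≼-trans (dist′≼dist x y) (dist-potential M y s))
      (⊕-⊓-glb δ (via z y) (via⁻ z y)
        (≼-trans (dist′≼via x y) (shift a b))
        (≼-trans (dist′≼via⁻ x y) (shift b a)))
      where
      δ = stepLen s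

      shift : ∀ u v → dist x u ⊕ dist v y ≼ δ ⊕ (dist z u ⊕ dist v y)
      shift u v = begin
        dist x u ⊕ dist v y         ≤⟨ ⊕-monoˡ (dist v y) (dist-potential M u s) ⟩
        (δ ⊕ dist z u) ⊕ dist v y   ≈⟨ ⊕-assoc δ (dist z u) (dist v y) ⟩
        δ ⊕ (dist z u ⊕ dist v y)   ∎

    0⊕dist : ∀ {c} u → c ≼ dist u y → c ≼ 𝟘 ⊕ dist u y
    0⊕dist u p = ≼-trans p (rhs≤lhs (⊕-identityˡ (dist u y)))

    0⊕detour : ∀ {c} u v w → c ≼ dist w y → c ≼ 𝟘 ⊕ (dist u v ⊕ dist w y)
    0⊕detour u v w p = ≼-trans p (≼-trans (x≼y⊕x (0≼dist M u v))
      (rhs≤lhs (⊕-identityˡ (dist u v ⊕ dist w y))))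

    detour-self : ∀ {c} u v → c ≼ dist u u ⊕ dist v y → c ≼ dist v y
    detour-self u v p = ≼-trans p (≼-trans
      (⊕-monoˡ (dist v y) (lower ε)) (lhs≤rhs (⊕-identityˡ (dist v y))))

    -- Every term of `dist′ b y` contains `dist b y` or `dist a y`. The former is matched by
    -- crossing at once from `a`, the latter by not crossing.
    a-to-b : dist′ a y ≼ 𝟘 ⊕ dist′ b y
    a-to-b = ⊕-⊓-glb 𝟘 (dist b y) (via b y ⊓ via⁻ b y) (0⊕dist b near)
      (⊕-⊓-glb 𝟘 (via b y) (via⁻ b y) (0⊕detour b a b near) (0⊕detour b b a (dist′≼dist a y)))
      where
      near : dist′ a y ≼ dist b y
      near = detour-self a b (dist′≼via a y)

    b-to-a : dist′ b y ≼ 𝟘 ⊕ dist′ a y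
    b-to-a = ⊕-⊓-glb 𝟘 (dist a y) (via a y ⊓ via⁻ a y) (0⊕dist a near)
      (⊕-⊓-glb 𝟘 (via a y) (via⁻ a y) (0⊕detour a a b (dist′≼dist b y)) (0⊕detour a b a near))
      where
      near : dist′ b y ≼ dist a y
      near = detour-self b a (dist′≼via⁻ b y)

    dist′-potential : Potential G′ (λ x → dist′ x y)
    dist′-potential (along e)                       = along-G (along e)
    dist′-potential (glue (atSource p))             = along-G (glue (atSource p))
    dist′-potential (glue (atTarget p))             = along-G (glue (atTarget p))
    dist′-potential (glue (byWormhole (here refl))) = a-to-b
    dist′-potential (glue (byWormhole (there m)))   = along-G (glue (byWormhole m))
    dist′-potential (glue⁻ (atSource p))             = along-G (glue⁻ (atSource p))
    dist′-potential (glue⁻ (atTarget p))             = along-G (glue⁻ (atTarget p))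
    dist′-potential (glue⁻ (byWormhole (here refl))) = b-to-a
    dist′-potential (glue⁻ (byWormhole (there m)))   = along-G (glue⁻ (byWormhole m))

  lower′ : ∀ {x y} (π : Path G′ x y) → dist′ x y ≼ len π
  lower′ {x} {y} π = begin
    dist′ x y          ≤⟨ potential⇒≼len (dist′-potential y) π ⟩
    len π ⊕ dist′ y y  ≤⟨ ⊕-monoʳ (len π) (≼-trans (dist′≼dist y y) (lower ε)) ⟩
    len π ⊕ 𝟘          ≈⟨ ⊕-identityʳ (len π) ⟩
    len π              ∎

  metric : Metric G′
  metric = record { dist = dist′ ; reach = reach′ ; lower = lower′ }

-- The star

NonExpansive : (ℝ → ℝ) → Set
NonExpansive f = ∀ t u → f t ≼ gap t u ⊕ f u

-- A function on Cauchy sequences need not respect equality of reals; a 1-Lipschitz one does, since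
-- equal reals have gap zero.
nonExpansive⇒cong : ∀ {f} → NonExpansive f → ∀ {t u} → t ≈ u → f t ≋ f u
nonExpansive⇒cong {f} f-ne {t} {u} t≈u =
  ≼-trans (f-ne t u) (drop (f u) gap≼𝟘) ,
  ≼-trans (f-ne u t) (drop (f t) (≼-trans (lhs≤rhs (gap-sym u t)) gap≼𝟘))
  where
  gap≼𝟘 : gap t u ≼ 𝟘
  gap≼𝟘 = gap≼0 t≈u

  drop : ∀ {d} x → d ≼ 𝟘 → d ⊕ x ≼ x
  drop x d≼0 = ≼-trans (⊕-monoˡ x d≼0) (lhs≤rhs (⊕-identityˡ x))

gap-self : ∀ t → gap t t ≼ 𝟘
gap-self t = gap≼0 (≋⇒≈ (Eq.refl {t}))

gap-𝟘ˡ : ∀ {t} → 𝟘 ≼ t → gap 𝟘 t ≋ t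
gap-𝟘ˡ {t} 0≼t =
  gap≼ (≼-trans 0≼t (x≼y⊕x 0≼t)) (rhs≤lhs (⊕-identityʳ t)) ,
  (begin
    t              ≤⟨ x≼gap⊕y t 𝟘 ⟩
    gap t 𝟘 ⊕ 𝟘    ≈⟨ ⊕-identityʳ (gap t 𝟘) ⟩
    gap t 𝟘        ≈⟨ gap-sym t 𝟘 ⟩
    gap 𝟘 t        ∎)

-- Polar coordinates: a spike and the distance from the centre. The centre has one such description
-- on every spike.
record Coord (s : ℕ) : Set where
  constructor coordinates
  field
    leg      : Fin s
    height   : ℝ
    0≼height : 𝟘 ≼ height

open Coord

at : ∀ {s} → (Fin s → ℝ → ℝ) → Coord s → ℝ
at f c = f (leg c) (height c)

-- A 1-Lipschitz function on the star, given spike by spike; the common central value `k` makes the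
-- pieces fit together.
record Radial {s} (f : Fin s → ℝ → ℝ) (k : ℝ) : Set where
  field
    nonExpansive : ∀ i → NonExpansive (f i)
    centre       : ∀ i → f i 𝟘 ≋ k

Respects : ∀ {s} → (Fin s → ℝ → ℝ) → List (Coord s × Coord s) → Set
Respects f = All λ (p , q) → at f p ≋ at f q

starWith : ∀ s → List (Wormhole (metricStar s)) → MetricGraph
starWith s ws = record { graph = MetricGraph.graph (metricStar s) ; identified = ws }

module _ {n : ℕ} where

  private s = suc n

  -- The centre is put on spike zero arbitrarily: radial functions agree there.
  coord : PointOf (metricStar s) → Coord s
  coord (vertex zero)    = coordinates zero 𝟘 ≼-refl
  coord (vertex (suc i)) = coordinates i 𝟙 0≼1
  coord (onEdge e t p q) = coordinates e t (subst (_≼ t) (sym 𝟘≡0ℝ) (≤⇒≼ p))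

  coords : List (Wormhole (metricStar s)) → List (Coord s × Coord s)
  coords = List.map (Product.map coord coord)

  height≼𝟙 : ∀ x → height (coord x) ≼ 𝟙
  height≼𝟙 (vertex zero)    = 0≼1
  height≼𝟙 (vertex (suc i)) = ≼-refl
  height≼𝟙 (onEdge e t p q) = subst (t ≼_) (sym 𝟙≡1ℝ) (≤⇒≼ q)

  module _ (ws : List (Wormhole (metricStar s))) where

    private G = starWith s ws

    -- Moving along an edge is controlled by the Lipschitz bound. Gluing does not change the value:
    -- at edge ends by congruence and the common central value, at wormholes by `Respects`.
    radial-potential : ∀ {f k} → Radial f k → Respects f (coords ws) → Potential G (at f ∘ coord)
    radial-potential {f} {k} radial respects = potential
      where
      open Radial radial

      glued : ∀ {x y} → Glued G x y → at f (coord x) ≋ at f (coord y)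
      glued (atSource {e} {t} t≈0) = Eq.trans (centre zero) (Eq.trans (Eq.sym (centre e))
        (Eq.sym (nonExpansive⇒cong (nonExpansive e) (subst (t ≈_) (sym 𝟘≡0ℝ) t≈0))))
      glued (atTarget {e} {t} t≈1) =
        Eq.sym (nonExpansive⇒cong (nonExpansive e) (subst (t ≈_) (sym 𝟙≡1ℝ) t≈1))
      glued (byWormhole m) = All.lookup (All.map⁻ respects) m

      potential : Potential G (at f ∘ coord)
      potential (along e {t} {u}) = nonExpansive e t u
      potential (glue {x} {y} g)  = ≼-trans (lhs≤rhs (glued g)) (x≼y⊕x ≼-refl)
      potential (glue⁻ {x} {y} g) = ≼-trans (rhs≤lhs (glued g)) (x≼y⊕x ≼-refl)

    onLeg : (e : Fin s) (t : ℝ) → 𝟘 ≼ t → t ≼ 𝟙 → PointOf G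
    onLeg e t p q = onEdge e t (≼⇒≤ (subst (_≼ t) 𝟘≡0ℝ p)) (≼⇒≤ (subst (t ≼_) 𝟙≡1ℝ q))

    hub : PointOf G
    hub = vertex zero

    -- Vertices are replaced by the edge ends glued to them, at no cost, so that paths can be built
    -- uniformly from `along`.
    representative : PointOf G → PointOf G
    representative x = onLeg (leg (coord x)) (height (coord x)) (0≼height (coord x)) (height≼𝟙 x)

    𝟘≈0ℝ : 𝟘 ≈ 0ℝ
    𝟘≈0ℝ = subst (𝟘 ≈_) 𝟘≡0ℝ (≋⇒≈ (Eq.refl {𝟘}))

    𝟙≈1ℝ : 𝟙 ≈ 1ℝ
    𝟙≈1ℝ = subst (𝟙 ≈_) 𝟙≡1ℝ (≋⇒≈ (Eq.refl {𝟙}))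

    to-representative : ∀ x → Reach G x (representative x) 𝟘
    to-representative (vertex zero)    = reach-step (glue (atSource 𝟘≈0ℝ))
    to-representative (vertex (suc i)) = reach-step (glue (atTarget 𝟙≈1ℝ))
    to-representative (onEdge e t p q) = reach-weaken (gap-self t) (reach-step (along e))

    from-representative : ∀ x → Reach G (representative x) x 𝟘
    from-representative (vertex zero)    = reach-step (glue⁻ (atSource 𝟘≈0ℝ))
    from-representative (vertex (suc i)) = reach-step (glue⁻ (atTarget 𝟙≈1ℝ))
    from-representative (onEdge e t p q) = reach-weaken (gap-self t) (reach-step (along e))

    to-hub : ∀ x → Reach G x hub (height (coord x))
    to-hub x = reach-weaken
      (begin
        (𝟘 ⊕ gap t 𝟘) ⊕ 𝟘  ≈⟨ ⊕-identityʳ (𝟘 ⊕ gap t 𝟘) ⟩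
        𝟘 ⊕ gap t 𝟘        ≈⟨ ⊕-identityˡ (gap t 𝟘) ⟩
        gap t 𝟘            ≈⟨ gap-sym t 𝟘 ⟩
        gap 𝟘 t            ≈⟨ gap-𝟘ˡ (0≼height (coord x)) ⟩
        t                  ∎)
      (reach-trans (𝟘 ⊕ gap t 𝟘) 𝟘
        (reach-trans 𝟘 (gap t 𝟘) (to-representative x)
          (reach-step {y = onLeg e 𝟘 ≼-refl 0≼1} (along e)))
        (reach-step (glue⁻ (atSource 𝟘≈0ℝ))))
      where
      e = leg (coord x)
      t = height (coord x)

    from-hub : ∀ x → Reach G hub x (height (coord x))
    from-hub x = reach-weaken
      (begin
        (𝟘 ⊕ gap 𝟘 t) ⊕ 𝟘  ≈⟨ ⊕-identityʳ (𝟘 ⊕ gap 𝟘 t) ⟩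
        𝟘 ⊕ gap 𝟘 t        ≈⟨ ⊕-identityˡ (gap 𝟘 t) ⟩
        gap 𝟘 t            ≈⟨ gap-𝟘ˡ (0≼height (coord x)) ⟩
        t                  ∎)
      (reach-trans (𝟘 ⊕ gap 𝟘 t) 𝟘
        (reach-trans 𝟘 (gap 𝟘 t)
          (reach-step {y = onLeg e 𝟘 ≼-refl 0≼1} (glue (atSource 𝟘≈0ℝ)))
          (reach-step {y = representative x} (along e)))
        (from-representative x))
      where
      e = leg (coord x)
      t = height (coord x)

    along-leg : ∀ x y → leg (coord x) ≡ leg (coord y) →
                Reach G x y (gap (height (coord x)) (height (coord y)))
    along-leg x y eq = reach-weaken
      (begin
        (𝟘 ⊕ g) ⊕ 𝟘  ≈⟨ ⊕-identityʳ (𝟘 ⊕ g) ⟩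
        𝟘 ⊕ g        ≈⟨ ⊕-identityˡ g ⟩
        g            ∎)
      (reach-trans (𝟘 ⊕ g) 𝟘
        (reach-trans 𝟘 g (to-representative x)
          (subst
            (λ e → Reach G (representative x)
                     (onLeg e (height (coord y)) (0≼height (coord y)) (height≼𝟙 y)) g)
            eq (reach-step (along (leg (coord x))))))
        (from-representative y))
      where
      g = gap (height (coord x)) (height (coord y))

  -- The distance to `c` in the star without wormholes: direct on the same spike, through the centre
  -- otherwise.
  distanceTo : Coord s → Fin s → ℝ → ℝ
  distanceTo c i t with i ≟ leg c
  ... | yes _ = gap t (height c)
  ... | no _  = t ⊕ height c

  distanceTo-radial : ∀ c → Radial (distanceTo c) (height c)
  distanceTo-radial c = record { nonExpansive = nonExpansive ; centre = at-centre }
    where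
    nonExpansive : ∀ i → NonExpansive (distanceTo c i)
    nonExpansive i t u with i ≟ leg c
    ... | yes _ = gap-triangle t u (height c)
    ... | no _  = ≼-trans (⊕-monoˡ (height c) (x≼gap⊕y t u))
                          (lhs≤rhs (⊕-assoc (gap t u) u (height c)))

    at-centre : ∀ i → distanceTo c i 𝟘 ≋ height c
    at-centre i with i ≟ leg c
    ... | yes _ = gap-𝟘ˡ (0≼height c)
    ... | no _  = ⊕-identityˡ (height c)

  -- The upper bound comes from the direct path or the path through the hub. The lower bound holds
  -- because the distance to `y` is a radial function, hence a potential, and vanishes at `y`.
  starMetric : Metric (starWith s [])
  starMetric = record
    { dist  = λ x y → at (distanceTo (coord y)) (coord x)
    ; reach = reach
    ; lower = λ {x} {y} π → ≼-trans
        (potential⇒≼len (radial-potential [] (distanceTo-radial (coord y)) []) π)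
        (≼-trans (⊕-monoʳ (len π) (self (coord y))) (lhs≤rhs (⊕-identityʳ (len π))))
    }
    where
    self : ∀ c → at (distanceTo c) c ≼ 𝟘
    self c with leg c ≟ leg c
    ... | yes _  = gap-self (height c)
    ... | no neq = contradiction refl neq

    reach : ∀ x y → Reach (starWith s []) x y (at (distanceTo (coord y)) (coord x))
    reach x y with leg (coord x) ≟ leg (coord y)
    ... | yes eq = along-leg [] x y eq
    ... | no _   = reach-trans (height (coord x)) (height (coord y)) (to-hub [] x) (from-hub [] y)

  metric : ExcludedMiddle 0ℓ → ∀ ws → Metric (starWith s ws)
  metric em []             = starMetric
  metric em ((a , b) ∷ ws) = AddWormhole.metric em (metric em ws) a b

-- Retractions closing wormholes

-- How one spike is mapped to another: a 1-Lipschitz change of height that keeps the centre in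
-- place.
record Shrink : Set where
  field
    apply        : ℝ → ℝ
    nonExpansive : NonExpansive apply
    fixes-𝟘      : apply 𝟘 ≋ 𝟘
    0≼apply      : ∀ {t} → 𝟘 ≼ t → 𝟘 ≼ apply t

open Shrink using (apply)

identity : Shrink
identity = record
  { apply = λ t → t ; nonExpansive = x≼gap⊕y ; fixes-𝟘 = Eq.refl ; 0≼apply = λ p → p }

collapse : Shrink
collapse = record
  { apply        = λ _ → 𝟘
  ; nonExpansive = λ t u → ≼-trans (0≼gap t u) (rhs≤lhs (⊕-identityʳ (gap t u)))
  ; fixes-𝟘      = Eq.refl
  ; 0≼apply      = λ _ → ≼-refl
  }

-- A certificate that two tips stay at distance at least 2: a 1-Lipschitz function that is
-- compatible with the wormholes and drops by 2 from `top` to `bot`.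
record Separation {s} (ws : List (Coord s × Coord s)) : Set where
  field
    f        : Fin s → ℝ → ℝ
    radial   : Radial f 𝟘
    respects : Respects f ws
    top bot  : Fin s
    far      : (𝟙 ⊕ 𝟙) ⊕ f bot 𝟙 ≼ f top 𝟙

-- A 1-Lipschitz map onto a star with one spike fewer that closes the wormhole from `p` to `q`.
-- Surviving spikes carry `identity` itself, so their tips go to tips.
record Retraction {s} (p q : Coord (suc s)) : Set where
  field
    fold    : Fin (suc s) → Fin s × Shrink
    section : Fin s → Fin (suc s)
    fixed   : ∀ i → fold (section i) ≡ (i , identity)

  push : Coord (suc s) → Coord s
  push (coordinates i t 0≼t) = let j , g = fold i in
    coordinates j (apply g t) (Shrink.0≼apply g 0≼t)

  field
    merges-leg    : leg (push p) ≡ leg (push q)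
    merges-height : height (push p) ≋ height (push q)

module _ (em : ExcludedMiddle 0ℓ) where
  open Order em

  shift : ∀ δ → 𝟘 ≼ δ → Shrink
  shift δ 0≼δ = record
    { apply        = λ t → (t ⊖ δ) ⊔ 𝟘
    ; nonExpansive = λ t u → ⊔-lub
        (begin
          t ⊖ δ                          ≤⟨ ⊖-monoˡ δ (x≼gap⊕y t u) ⟩
          (gap t u ⊕ u) ⊖ δ              ≈⟨ [x⊕y]⊖z (gap t u) u δ ⟩
          gap t u ⊕ (u ⊖ δ)              ≤⟨ ⊕-monoʳ (gap t u) (x≼x⊔y (u ⊖ δ) 𝟘) ⟩
          gap t u ⊕ ((u ⊖ δ) ⊔ 𝟘)        ∎)
        (≼-trans (x≼y⊔x (u ⊖ δ) 𝟘) (x≼y⊕x (0≼gap t u)))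
    ; fixes-𝟘      = ⊔-lub
        (begin
          𝟘 ⊖ δ        ≤⟨ ⊖-monoˡ δ (≼-trans 0≼δ (rhs≤lhs (⊕-identityˡ δ))) ⟩
          (𝟘 ⊕ δ) ⊖ δ  ≈⟨ x⊕y⊖y 𝟘 δ ⟩
          𝟘            ∎)
        ≼-refl
      , x≼y⊔x (𝟘 ⊖ δ) 𝟘
    ; 0≼apply      = λ {t} _ → x≼y⊔x (t ⊖ δ) 𝟘
    }

  -- The height `b` is lowered to `b - (b - a) = a`, where the cut-off at zero has no effect.
  shift-to : ∀ {a b} (0≼b⊖a : 𝟘 ≼ b ⊖ a) → 𝟘 ≼ a → a ≋ apply (shift (b ⊖ a) 0≼b⊖a) b
  shift-to {a} {b} _ 0≼a =
    ≼-trans (rhs≤lhs (y⊖[y⊖x] a b)) (x≼x⊔y (b ⊖ (b ⊖ a)) 𝟘) ,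
    ⊔-lub (lhs≤rhs (y⊖[y⊖x] a b)) 0≼a

  -- The spike of `q` is mapped to spike `h` by `g` and the others are kept. The merging condition
  -- is asked of every `fold` with these values, which hides its construction by `insertAt`.
  removeLeg : ∀ {s} (p q : Coord (suc s)) (h : Fin s) (g : Shrink) →
              (∀ fold → (∀ i → fold (punchIn (leg q) i) ≡ (i , identity)) →
                fold (leg q) ≡ (h , g) →
                proj₁ (fold (leg p)) ≡ h ×
                apply (proj₂ (fold (leg p))) (height p) ≋ apply g (height q)) →
              Retraction p q
  removeLeg {s} p q h g merges = record
    { fold          = fold
    ; section       = punchIn (leg q)
    ; fixed         = fixed
    ; merges-leg    = trans (proj₁ merged) (sym (cong proj₁ removed))
    ; merges-height = subst
        (λ r → apply (proj₂ (fold (leg p))) (height p) ≋ apply (proj₂ r) (height q))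
        (sym removed) (proj₂ merged)
    }
    where
    fold : Fin (suc s) → Fin s × Shrink
    fold = insertAt (_, identity) (leg q) (h , g)

    fixed : ∀ i → fold (punchIn (leg q) i) ≡ (i , identity)
    fixed = insertAt-punchIn (_, identity) (leg q) (h , g)

    removed : fold (leg q) ≡ (h , g)
    removed = insertAt-lookup (_, identity) (leg q) (h , g)

    merged = merges fold fixed removed

  -- spare is where a spike carrying both ends of the wormhole is collapsed to;
  -- any spike will do, since only its centre is hit.
  retract : ∀ {s} → Fin s → (p q : Coord (suc s)) → height p ≼ height q → Retraction p q
  retract spare p q a≼b with leg q ≟ leg p
  -- `p` lies on the removed spike too, so both ends land at the centre.
  ... | yes eq = removeLeg p q spare collapse λ fold _ removed →
    subst (λ r → proj₁ r ≡ spare × apply (proj₂ r) (height p) ≋ 𝟘)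
      (trans (sym removed) (cong fold eq)) (refl , Eq.refl)
  -- `p` stays where it is, and the shift brings `q` down to the height of `p` on the same spike.
  ... | no neq = removeLeg p q (punchOut neq) (shift (height q ⊖ height p) 0≼b⊖a) λ fold fixed _ →
    subst (λ r → proj₁ r ≡ punchOut neq ×
                 apply (proj₂ r) (height p) ≋ apply (shift (height q ⊖ height p) 0≼b⊖a) (height q))
      (trans (sym (fixed (punchOut neq))) (cong fold (Fin.punchIn-punchOut neq)))
      (refl , shift-to 0≼b⊖a (0≼height p))
    where
    0≼b⊖a : 𝟘 ≼ height q ⊖ height p
    0≼b⊖a = begin
      𝟘                          ≈⟨ x⊕y⊖y 𝟘 (height p) ⟨
      (𝟘 ⊕ height p) ⊖ height p  ≤⟨ ⊖-monoˡ (height p) (lhs≤rhs (⊕-identityˡ (height p))) ⟩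
      height p ⊖ height p        ≤⟨ ⊖-monoˡ (height p) a≼b ⟩
      height q ⊖ height p        ∎

  -- Compose the separating function with the retraction. It respects the new wormhole because both
  -- ends have the same image, and `section` finds the old spikes whose tips are still 2 apart in
  -- value.
  pull-back : ∀ {s p q} (r : Retraction {s} p q) {ws} →
              Separation (List.map (Product.map (Retraction.push r) (Retraction.push r)) ws) →
              Separation ((p , q) ∷ ws)
  pull-back {s} {p} {q} r {ws} separation = record
    { f        = λ i t → f (proj₁ (fold i)) (apply (proj₂ (fold i)) t)
    ; radial   = record
      { nonExpansive = λ i t u → let j , g = fold i in begin
          f j (apply g t)                                ≤⟨ nonExpansive j (apply g t) (apply g u) ⟩
          gap (apply g t) (apply g u) ⊕ f j (apply g u)  ≤⟨ ⊕-monoˡ _ (gap-apply g t u) ⟩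
          gap t u ⊕ f j (apply g u)                      ∎
      ; centre       = λ i → let j , g = fold i in
          Eq.trans (nonExpansive⇒cong (nonExpansive j) (≋⇒≈ (Shrink.fixes-𝟘 g))) (centre j)
      }
    ; respects = merged ∷ All.map⁻ respects
    ; top      = section top
    ; bot      = section bot
    ; far      = begin
        (𝟙 ⊕ 𝟙) ⊕ f (proj₁ (fold (section bot))) (apply (proj₂ (fold (section bot))) 𝟙)
          ≡⟨ cong (λ r → (𝟙 ⊕ 𝟙) ⊕ f (proj₁ r) (apply (proj₂ r) 𝟙)) (fixed bot) ⟩
        (𝟙 ⊕ 𝟙) ⊕ f bot 𝟙
          ≤⟨ far ⟩
        f top 𝟙
          ≡⟨ cong (λ r → f (proj₁ r) (apply (proj₂ r) 𝟙)) (fixed top) ⟨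
        f (proj₁ (fold (section top))) (apply (proj₂ (fold (section top))) 𝟙) ∎
    }
    where
    open Retraction r
    open Separation separation
    open Radial radial

    gap-apply : ∀ g t u → gap (apply g t) (apply g u) ≼ gap t u
    gap-apply g t u = gap≼ (Shrink.nonExpansive g t u)
      (≼-trans (Shrink.nonExpansive g u t) (⊕-monoˡ _ (lhs≤rhs (gap-sym u t))))

    merged : at f (push p) ≋ at f (push q)
    merged = subst (λ j → f (leg (push p)) (height (push p)) ≋ f j (height (push q)))
      merges-leg (nonExpansive⇒cong (nonExpansive (leg (push p))) (≋⇒≈ merges-height))

  swap : ∀ {s p q} {ws : List (Coord s × Coord s)} →
         Separation ((p , q) ∷ ws) → Separation ((q , p) ∷ ws)
  swap separation with Separation.respects separation
  ... | fp≋fq ∷ rest = record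
    { f = f ; radial = radial ; respects = Eq.sym fp≋fq ∷ rest ; top = top ; bot = bot ; far = far }
    where open Separation separation

  -- The spike of the higher end is removed. Which retraction this gives depends on the comparison
  -- of heights, so the smaller star is asked to be separated for every possible image of the other
  -- wormholes.
  close-wormhole : ∀ {s} → Fin s → ∀ p q {ws} →
                   (∀ (g : Coord (suc s) → Coord s) → Separation (List.map (Product.map g g) ws)) →
                   Separation ((p , q) ∷ ws)
  close-wormhole spare p q separation with ≼-total em (height p) (height q)
  ... | inj₁ a≼b = let r = retract spare p q a≼b in
    pull-back r (separation (Retraction.push r))
  ... | inj₂ b≼a = let r = retract spare q p b≼a in
    swap (pull-back r (separation (Retraction.push r)))

  -- Each retraction uses up one spike and one wormhole, which preserves the bound, and carries the
  -- remaining wormholes to the smaller star. Without wormholes the function is t on one spike, -t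
  -- on a second and zero elsewhere.
  separate : ∀ {s} (ws : List (Coord s × Coord s)) → 2 ℕ.+ List.length ws ℕ.≤ s → Separation ws
  separate {suc zero}    []       (ℕ.s≤s ())
  separate {suc (suc s)} [] _ = record
    { f        = f
    ; radial   = record { nonExpansive = nonExpansive ; centre = centre′ }
    ; respects = []
    ; top      = zero
    ; bot      = suc zero
    ; far      = lhs≤rhs 2⊖1
    }
    where
    f : Fin (suc (suc s)) → ℝ → ℝ
    f zero          t = t
    f (suc zero)    t = 𝟘 ⊖ t
    f (suc (suc _)) t = 𝟘

    nonExpansive : ∀ i → NonExpansive (f i)
    nonExpansive zero          = x≼gap⊕y
    nonExpansive (suc zero)    = ⊖-antitone
    nonExpansive (suc (suc _)) = Shrink.nonExpansive collapse

    centre′ : ∀ i → f i 𝟘 ≋ 𝟘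
    centre′ zero          = Eq.refl
    centre′ (suc zero)    = 0⊖0
    centre′ (suc (suc _)) = Eq.refl
  separate {suc (suc s)} ((p , q) ∷ ws) (ℕ.s≤s 2+k≤s) = close-wormhole zero p q λ g →
    separate _ (subst (λ k → 2 ℕ.+ k ℕ.≤ suc s) (sym (List.length-map (Product.map g g) ws)) 2+k≤s)

  -- The diameter

  diameter : ∀ {s} ws → 2 ℕ.+ List.length ws ℕ.≤ suc s → IsDiameter (starWith (suc s) ws) 2ℝ
  diameter {s} ws 2+k≤s =
    (λ x y → dist x y , isDistance M x y , ≼⇒≤ (dist≼2 x y)) ,
    tip top , tip bot , distance-2
    where
    M = metric em ws
    open Metric M
    open Separation (separate (coords ws)
      (subst (λ k → 2 ℕ.+ k ℕ.≤ suc s) (sym (List.length-map _ ws)) 2+k≤s))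

    tip : Fin (suc s) → PointOf (metricStar (suc s))
    tip i = vertex (suc i)

    -- Any two points are joined through the hub, at height at most 1 each.
    dist≼2 : ∀ x y → dist x y ≼ 2ℝ
    dist≼2 x y =
      let t = height (coord x)
          u = height (coord y)
          π , π≼t⊕u = reach-trans t u (to-hub ws x) (from-hub ws y)
      in begin
      dist x y  ≤⟨ lower π ⟩
      len π     ≤⟨ π≼t⊕u ⟩
      t ⊕ u     ≤⟨ ⊕-mono (height≼𝟙 x) (height≼𝟙 y) ⟩
      𝟙 ⊕ 𝟙     ≈⟨ 𝟙⊕𝟙≋2ℝ ⟩
      2ℝ        ∎

    -- The separating function f gives 2 + f(bot) ≤ f(top) ≤ len π + f(bot), and f(bot) cancels.
    2≼len : (π : Path (starWith (suc s) ws) (tip top) (tip bot)) → 2ℝ ≼ len π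
    2≼len π = ≼-trans (rhs≤lhs 𝟙⊕𝟙≋2ℝ)
      (⊕-cancelʳ (f bot 𝟙) (≼-trans far (potential⇒≼len (radial-potential ws radial respects) π)))

    distance-2 : IsDistance (starWith (suc s) ws) (tip top) (tip bot) 2ℝ
    distance-2 = let π , π≼ = reach (tip top) (tip bot) in
      (π , subst (_≈ 2ℝ) (len≡length π) (≋⇒≈ (≼-trans π≼ (dist≼2 (tip top) (tip bot)) , 2≼len π))) ,
      λ ρ → subst (2ℝ ≤_) (len≡length ρ) (≼⇒≤ (2≼len ρ))

proposition10 :
    ExcludedMiddle 0ℓ →
    (s : ℕ) → 2 ℕ.≤ s →
    (wormholes : Vec (Wormhole (metricStar s)) (s ∸ 2)) →
    IsDiameter (metricStar s) 2ℝ ×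
    IsDiameter (addWormholes (metricStar s) wormholes) 2ℝ
proposition10 em (suc s) 2≤s wormholes =
  -- The star itself is the case of no wormholes.
  diameter em [] 2≤s ,
  diameter em ws (ℕ.≤-reflexive (trans (cong (2 ℕ.+_) length-ws) (ℕ.m+[n∸m]≡n 2≤s)))
  where
  -- The final `[]` is the star's own list of identifications, appended by `addWormholes`.
  ws = Vec.toList wormholes List.++ []

  length-ws : List.length ws ≡ suc s ∸ 2
  length-ws = trans (cong List.length (List.++-identityʳ (Vec.toList wormholes)))
                    (Vec.length-toList wormholes)
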